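{- The logics $\mathrm{C}$, $\mathrm{C3}$, $\mathrm{MC}$ and $\mathrm{CN}$, given by the sequent calculi $\mathrm{sC}$, $\mathrm{sC3}$, $\mathrm{sMC}$ and $\mathrm{sCN}$ respectively, are pairwise not logically equivalent; that is, for any two distinct calculi among these four, the sets of sequents provable in them are different.
   Context: Formulas are built from countably many propositional variables $p,q,\dots$ using the binary connectives $\land,\lor,\to$ and the unary connective $\sim$. A sequent is an expression $\Gamma\Rightarrow\gamma$ with $\Gamma$ a finite (possibly empty) set of formulas and $\gamma$ a single formula; $\alpha,\Gamma$ means $\{\alpha\}\cup\Gamma$ and $\Gamma,\Delta$ means $\Gamma\cup\Delta$. The calculus $\mathrm{sC}$ has the following initial sequents and rules ($p$ any propositional variable; $\alpha,\beta,\gamma$ any formulas; $\Gamma,\Delta,\Sigma$ any finite sets of formulas). Initial sequents: (init1) $p,\Gamma\Rightarrow p$; (init2) $\sim p,\Gamma\Rightarrow\sim p$. (cut): from $\Gamma\Rightarrow\alpha$ and $\alpha,\Sigma\Rightarrow\gamma$ infer $\Gamma,\Sigma\Rightarrow\gamma$. ($\to$left): from $\Gamma\Rightarrow\alpha$ and $\beta,\Delta\Rightarrow\gamma$ infer $\alpha\to\beta,\Gamma,\Delta\Rightarrow\gamma$. ($\to$right): from $\alpha,\Gamma\Rightarrow\beta$ infer $\Gamma\Rightarrow\alpha\to\beta$. ($\land$left): from $\alpha,\beta,\Gamma\Rightarrow\gamma$ infer $\alpha\land\beta,\Gamma\Rightarrow\gamma$. ($\land$right): from $\Gamma\Rightarrow\alpha$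 and $\Gamma\Rightarrow\beta$ infer $\Gamma\Rightarrow\alpha\land\beta$. ($\lor$left): from $\alpha,\Gamma\Rightarrow\gamma$ and $\beta,\Gamma\Rightarrow\gamma$ infer $\alpha\lor\beta,\Gamma\Rightarrow\gamma$. ($\lor$right1), ($\lor$right2): from $\Gamma\Rightarrow\alpha$ (respectively $\Gamma\Rightarrow\beta$) infer $\Gamma\Rightarrow\alpha\lor\beta$. ($\sim$left): from $\alpha,\Gamma\Rightarrow\gamma$ infer $\sim\sim\alpha,\Gamma\Rightarrow\gamma$. ($\sim$right): from $\Gamma\Rightarrow\alpha$ infer $\Gamma\Rightarrow\sim\sim\alpha$. ($\sim\to$left): from $\Gamma\Rightarrow\alpha$ and $\sim\beta,\Delta\Rightarrow\gamma$ infer $\sim(\alpha\to\beta),\Gamma,\Delta\Rightarrow\gamma$. ($\sim\to$right): from $\alpha,\Gamma\Rightarrow\sim\beta$ infer $\Gamma\Rightarrow\sim(\alpha\to\beta)$. ($\sim\land$left): from $\sim\alpha,\Gamma\Rightarrow\gamma$ and $\sim\beta,\Gamma\Rightarrow\gamma$ infer $\sim(\alpha\land\beta),\Gamma\Rightarrow\gamma$. ($\sim\land$right1), ($\sim\land$right2): from $\Gamma\Rightarrow\sim\alpha$ (respectively $\Gamma\Rightarrow\sim\beta$) infer $\Gamma\Rightarrow\sim(\alpha\land\beta)$. ($\sim\lor$left): from $\sim\alpha,\sim\beta,\Gamma\Rightarrow\gamma$ infer $\sim(\alpha\lor\beta),\Gamma\Rightarrow\gamma$. ($\sim\lor$right):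 from $\Gamma\Rightarrow\sim\alpha$ and $\Gamma\Rightarrow\sim\beta$ infer $\Gamma\Rightarrow\sim(\alpha\lor\beta)$. Additional rules: (ex-middle): from $\sim\alpha,\Gamma\Rightarrow\gamma$ and $\alpha,\Gamma\Rightarrow\gamma$ infer $\Gamma\Rightarrow\gamma$. (Peirce): from $\alpha\to\beta,\Gamma\Rightarrow\alpha$ infer $\Gamma\Rightarrow\alpha$. $\mathrm{sC3}=\mathrm{sC}+$(ex-middle); $\mathrm{sMC}=\mathrm{sC}+$(Peirce); $\mathrm{sCN}=\mathrm{sC3}+$(Peirce). -}

module Defs where

open import Data.List using (List; _∷_; _++_)
open import Data.List.Relation.Binary.BagAndSetEquality using (_∼[_]_; set)
open import Data.Nat using (ℕ)
open import Level using (0ℓ)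
open import Relation.Unary using (Pred)

infix  9 ∼_
infixr 8 _∧_
infixr 7 _∨_
infixr 6 _⟶_
infix  4 _⇒_
infix  3 _⊢_

data Formula : Set where
  var         : ℕ → Formula
  _∧_ _∨_ _⟶_ : Formula → Formula → Formula
  ∼_          : Formula → Formula

-- A finite set of formulas is represented by a list of its elements: α , Γ is
-- α ∷ Γ, and Γ , Δ is Γ ++ Δ. Lists with the same elements denote the same
-- set; the constructor `resp` of _⊢_ makes provability respect this.
record Sequent : Set where
  constructor _⇒_
  field
    antecedent : List Formula
    succedent  : Formula

data Calculus : Set where
  sC sC3 sMC sCN : Calculus

data HasExMiddle : Calculus → Set where
  sC3 : HasExMiddle sC3
  sCN : HasExMiddle sCN

data HasPeirce : Calculus → Set where
  sMC : HasPeirce sMC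
  sCN : HasPeirce sCN

data _⊢_ (L : Calculus) : Pred Sequent 0ℓ where

  -- Not an inference rule: it identifies lists representing the same set.
  resp : ∀ {Γ Γ′ γ} → Γ ∼[ set ] Γ′ → L ⊢ Γ ⇒ γ → L ⊢ Γ′ ⇒ γ

  init1 : ∀ {p Γ} → L ⊢ var p ∷ Γ ⇒ var p
  init2 : ∀ {p Γ} → L ⊢ ∼ var p ∷ Γ ⇒ ∼ var p

  cut : ∀ {Γ Σ α γ} → L ⊢ Γ ⇒ α → L ⊢ α ∷ Σ ⇒ γ → L ⊢ Γ ++ Σ ⇒ γ

  ⟶left   : ∀ {Γ Δ α β γ} → L ⊢ Γ ⇒ α → L ⊢ β ∷ Δ ⇒ γ →
            L ⊢ (α ⟶ β) ∷ Γ ++ Δ ⇒ γ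
  ⟶right  : ∀ {Γ α β} → L ⊢ α ∷ Γ ⇒ β → L ⊢ Γ ⇒ α ⟶ β
  ∧left   : ∀ {Γ α β γ} → L ⊢ α ∷ β ∷ Γ ⇒ γ → L ⊢ (α ∧ β) ∷ Γ ⇒ γ
  ∧right  : ∀ {Γ α β} → L ⊢ Γ ⇒ α → L ⊢ Γ ⇒ β → L ⊢ Γ ⇒ α ∧ β
  ∨left   : ∀ {Γ α β γ} → L ⊢ α ∷ Γ ⇒ γ → L ⊢ β ∷ Γ ⇒ γ →
            L ⊢ (α ∨ β) ∷ Γ ⇒ γ
  ∨right1 : ∀ {Γ α β} → L ⊢ Γ ⇒ α → L ⊢ Γ ⇒ α ∨ β
  ∨right2 : ∀ {Γ α β} → L ⊢ Γ ⇒ β → L ⊢ Γ ⇒ α ∨ β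

  ∼left    : ∀ {Γ α γ} → L ⊢ α ∷ Γ ⇒ γ → L ⊢ ∼ ∼ α ∷ Γ ⇒ γ
  ∼right   : ∀ {Γ α} → L ⊢ Γ ⇒ α → L ⊢ Γ ⇒ ∼ ∼ α
  ∼⟶left   : ∀ {Γ Δ α β γ} → L ⊢ Γ ⇒ α → L ⊢ ∼ β ∷ Δ ⇒ γ →
             L ⊢ ∼ (α ⟶ β) ∷ Γ ++ Δ ⇒ γ
  ∼⟶right  : ∀ {Γ α β} → L ⊢ α ∷ Γ ⇒ ∼ β → L ⊢ Γ ⇒ ∼ (α ⟶ β)
  ∼∧left   : ∀ {Γ α β γ} → L ⊢ ∼ α ∷ Γ ⇒ γ → L ⊢ ∼ β ∷ Γ ⇒ γ →
             L ⊢ ∼ (α ∧ β) ∷ Γ ⇒ γ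
  ∼∧right1 : ∀ {Γ α β} → L ⊢ Γ ⇒ ∼ α → L ⊢ Γ ⇒ ∼ (α ∧ β)
  ∼∧right2 : ∀ {Γ α β} → L ⊢ Γ ⇒ ∼ β → L ⊢ Γ ⇒ ∼ (α ∧ β)
  ∼∨left   : ∀ {Γ α β γ} → L ⊢ ∼ α ∷ ∼ β ∷ Γ ⇒ γ → L ⊢ ∼ (α ∨ β) ∷ Γ ⇒ γ
  ∼∨right  : ∀ {Γ α β} → L ⊢ Γ ⇒ ∼ α → L ⊢ Γ ⇒ ∼ β → L ⊢ Γ ⇒ ∼ (α ∨ β)

  ex-middle : ∀ {Γ α γ} → HasExMiddle L →
              L ⊢ ∼ α ∷ Γ ⇒ γ → L ⊢ α ∷ Γ ⇒ γ → L ⊢ Γ ⇒ γ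
  Peirce    : ∀ {Γ α β} → HasPeirce L → L ⊢ (α ⟶ β) ∷ Γ ⇒ α → L ⊢ Γ ⇒ α

Provable : Calculus → Pred Sequent 0ℓ
Provable L S = L ⊢ S

{-# OPTIONS --safe #-}

-- sC is sound for Kripke models with two independent forcing relations,
-- verification and falsification, where ∼ exchanges the two. If every world
-- verifies or falsifies each variable, then it verifies or falsifies each
-- formula, which validates (ex-middle); if accessibility is symmetric and the
-- valuation decidable, then implication is classical, which validates
-- (Peirce). So p ∨ ∼ p separates the calculi with (ex-middle) from the others
-- (take one world where no variable is verified or falsified), and Peirce's
-- law separates those with (Peirce) from the others (take two worlds, all
-- variables falsified everywhere and p verified at the upper one only).
module Submission where

open import Defs
open import Data.Bool using (Bool; true; false; T; f≤t; b≤b) renaming (_≤_ to _≤ᵇ_)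
import Data.Bool.Properties as Bool
open import Data.Empty using (⊥)
open import Data.List using ([]; _∷_; [_])
open import Data.List.Relation.Binary.BagAndSetEquality using (bag-=⇒; ↭⇒∼bag; set; _∼[_]_)
open import Data.List.Relation.Binary.Permutation.Propositional using (swap; ↭-refl)
open import Data.List.Relation.Unary.All as All using (All; []; _∷_)
open import Data.List.Relation.Unary.All.Properties using (++⁻)
open import Data.Nat using (ℕ)
open import Data.Product using (_×_; _,_; proj₁; proj₂)
open import Data.Sum as Sum using (_⊎_; inj₁; inj₂)
open import Data.Unit using (⊤; tt)
open import Function using (_∘_; const; mk⇔; module Equivalence)
open import Level using (0ℓ)
open import Relation.Binary using (Rel; Reflexive; Transitive; Symmetric)
open import Relation.Binary.PropositionalEquality
  using (_≡_; _≢_; refl; cong₂; module ≡-Reasoning)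
open import Relation.Nullary using (¬_; Dec; yes; no; contradiction)
open import Relation.Nullary.Decidable
  using (does; does-⇔; map′; _×-dec_; _⊎-dec_; _→-dec_)
open import Relation.Unary using (_≐_)

record Model : Set₁ where
  infix 4 _≤_
  field
    World   : Set
    _≤_     : Rel World 0ℓ
    ≤-refl  : Reflexive _≤_
    ≤-trans : Transitive _≤_
    V⁺ V⁻   : ℕ → World → Set
    V⁺-mono : ∀ {n u v} → u ≤ v → V⁺ n u → V⁺ n v
    V⁻-mono : ∀ {n u v} → u ≤ v → V⁻ n u → V⁻ n v

module Forcing (M : Model) where
  open Model M

  infix 4 _⊩_ _⊩⁻_

  mutual
    _⊩_ : World → Formula → Set
    w ⊩ var n   = V⁺ n w
    w ⊩ α ∧ β   = w ⊩ α × w ⊩ β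
    w ⊩ α ∨ β   = w ⊩ α ⊎ w ⊩ β
    w ⊩ (α ⟶ β) = ∀ {v} → w ≤ v → v ⊩ α → v ⊩ β
    w ⊩ ∼ α     = w ⊩⁻ α

    _⊩⁻_ : World → Formula → Set
    w ⊩⁻ var n   = V⁻ n w
    w ⊩⁻ α ∧ β   = w ⊩⁻ α ⊎ w ⊩⁻ β
    w ⊩⁻ α ∨ β   = w ⊩⁻ α × w ⊩⁻ β
    w ⊩⁻ (α ⟶ β) = ∀ {v} → w ≤ v → v ⊩ α → v ⊩⁻ β
    w ⊩⁻ ∼ α     = w ⊩ α

  mutual
    ⊩-mono : ∀ {u v} α → u ≤ v → u ⊩ α → v ⊩ α
    ⊩-mono (var n) u≤v a       = V⁺-mono u≤v a
    ⊩-mono (α ∧ β) u≤v (a , b) = ⊩-mono α u≤v a , ⊩-mono β u≤v b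
    ⊩-mono (α ∨ β) u≤v         = Sum.map (⊩-mono α u≤v) (⊩-mono β u≤v)
    ⊩-mono (α ⟶ β) u≤v f v≤w   = f (≤-trans u≤v v≤w)
    ⊩-mono (∼ α)   u≤v a       = ⊩⁻-mono α u≤v a

    ⊩⁻-mono : ∀ {u v} α → u ≤ v → u ⊩⁻ α → v ⊩⁻ α
    ⊩⁻-mono (var n) u≤v a       = V⁻-mono u≤v a
    ⊩⁻-mono (α ∧ β) u≤v         = Sum.map (⊩⁻-mono α u≤v) (⊩⁻-mono β u≤v)
    ⊩⁻-mono (α ∨ β) u≤v (a , b) = ⊩⁻-mono α u≤v a , ⊩⁻-mono β u≤v b
    ⊩⁻-mono (α ⟶ β) u≤v f v≤w   = f (≤-trans u≤v v≤w)
    ⊩⁻-mono (∼ α)   u≤v a       = ⊩-mono α u≤v a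

  ⊩*-mono : ∀ {u v Γ} → u ≤ v → All (u ⊩_) Γ → All (v ⊩_) Γ
  ⊩*-mono u≤v = All.map (λ {α} → ⊩-mono α u≤v)

  Valid : Sequent → Set
  Valid (Γ ⇒ γ) = ∀ {w} → All (w ⊩_) Γ → w ⊩ γ

  Total : Set
  Total = ∀ n w → V⁺ n w ⊎ V⁻ n w

  module _ (V-total : Total) where

    ⊩-total : ∀ α w → w ⊩ α ⊎ w ⊩⁻ α
    ⊩-total (var n) w = V-total n w
    ⊩-total (α ∧ β) w with ⊩-total α w | ⊩-total β w
    ... | inj₁ a  | inj₁ b  = inj₁ (a , b)
    ... | inj₁ _  | inj₂ b⁻ = inj₂ (inj₂ b⁻)
    ... | inj₂ a⁻ | _       = inj₂ (inj₁ a⁻)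
    ⊩-total (α ∨ β) w with ⊩-total α w | ⊩-total β w
    ... | inj₁ a  | _       = inj₁ (inj₁ a)
    ... | inj₂ _  | inj₁ b  = inj₁ (inj₂ b)
    ... | inj₂ a⁻ | inj₂ b⁻ = inj₂ (a⁻ , b⁻)
    ⊩-total (α ⟶ β) w =
      Sum.map (λ b w≤v _ → ⊩-mono β w≤v b) (λ b⁻ w≤v _ → ⊩⁻-mono β w≤v b⁻)
              (⊩-total β w)
    ⊩-total (∼ α) w = Sum.swap (⊩-total α w)

  record Classical : Set where
    field
      ≤-sym : Symmetric _≤_
      V⁺?   : ∀ n w → Dec (V⁺ n w)
      V⁻?   : ∀ n w → Dec (V⁻ n w)

    mutual
      _⊩?_ : ∀ w α → Dec (w ⊩ α)
      w ⊩? var n   = V⁺? n w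
      w ⊩? (α ∧ β) = (w ⊩? α) ×-dec (w ⊩? β)
      w ⊩? (α ∨ β) = (w ⊩? α) ⊎-dec (w ⊩? β)
      w ⊩? (α ⟶ β) =
        map′ (λ f w≤v → ⊩-mono β w≤v ∘ f ∘ ⊩-mono α (≤-sym w≤v))
             (λ f → f ≤-refl)
             ((w ⊩? α) →-dec (w ⊩? β))
      w ⊩? (∼ α)   = w ⊩⁻? α

      _⊩⁻?_ : ∀ w α → Dec (w ⊩⁻ α)
      w ⊩⁻? var n   = V⁻? n w
      w ⊩⁻? (α ∧ β) = (w ⊩⁻? α) ⊎-dec (w ⊩⁻? β)
      w ⊩⁻? (α ∨ β) = (w ⊩⁻? α) ×-dec (w ⊩⁻? β)
      w ⊩⁻? (α ⟶ β) =
        map′ (λ f w≤v → ⊩⁻-mono β w≤v ∘ f ∘ ⊩-mono α (≤-sym w≤v))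
             (λ f → f ≤-refl)
             ((w ⊩? α) →-dec (w ⊩⁻? β))
      w ⊩⁻? (∼ α)   = w ⊩? α

    ⊩-Peirce : ∀ {w} α β → (w ⊩ α ⟶ β → w ⊩ α) → w ⊩ α
    ⊩-Peirce {w} α β f with w ⊩? α
    ... | yes a = a
    ... | no ¬a = f λ w≤v a → contradiction (⊩-mono α (≤-sym w≤v) a) ¬a

  module _ {L : Calculus}
           (total     : HasExMiddle L → Total)
           (classical : HasPeirce L → Classical) where

    sound : ∀ {S} → L ⊢ S → Valid S
    sound (resp Γ∼Γ′ d) hs =
      sound d (All.tabulate (All.lookup hs ∘ Equivalence.to Γ∼Γ′))
    sound init1 (h ∷ _) = h
    sound init2 (h ∷ _) = h
    sound (cut {Γ} d e) hs with gs , ss ← ++⁻ Γ hs = sound e (sound d gs ∷ ss)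
    sound (⟶left {Γ} d e) (f ∷ hs) with gs , ds ← ++⁻ Γ hs =
      sound e (f ≤-refl (sound d gs) ∷ ds)
    sound (⟶right d) hs w≤v a = sound d (a ∷ ⊩*-mono w≤v hs)
    sound (∧left d) ((a , b) ∷ hs) = sound d (a ∷ b ∷ hs)
    sound (∧right d e) hs = sound d hs , sound e hs
    sound (∨left d e) (inj₁ a ∷ hs) = sound d (a ∷ hs)
    sound (∨left d e) (inj₂ b ∷ hs) = sound e (b ∷ hs)
    sound (∨right1 d) hs = inj₁ (sound d hs)
    sound (∨right2 d) hs = inj₂ (sound d hs)
    sound (∼left d) (a ∷ hs) = sound d (a ∷ hs)
    sound (∼right d) hs = sound d hs
    sound (∼⟶left {Γ} d e) (f ∷ hs) with gs , ds ← ++⁻ Γ hs =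
      sound e (f ≤-refl (sound d gs) ∷ ds)
    sound (∼⟶right d) hs w≤v a = sound d (a ∷ ⊩*-mono w≤v hs)
    sound (∼∧left d e) (inj₁ a ∷ hs) = sound d (a ∷ hs)
    sound (∼∧left d e) (inj₂ b ∷ hs) = sound e (b ∷ hs)
    sound (∼∧right1 d) hs = inj₁ (sound d hs)
    sound (∼∧right2 d) hs = inj₂ (sound d hs)
    sound (∼∨left d) ((a , b) ∷ hs) = sound d (a ∷ b ∷ hs)
    sound (∼∨right d e) hs = sound d hs , sound e hs
    sound (ex-middle {α = α} x d e) {w} hs with ⊩-total (total x) α w
    ... | inj₁ a  = sound e (a ∷ hs)
    ... | inj₂ a⁻ = sound d (a⁻ ∷ hs)
    sound (Peirce {α = α} {β} x d) hs =
      Classical.⊩-Peirce (classical x) α β λ f → sound d ((λ {v} → f {v}) ∷ hs)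

open Forcing using (Valid; Total; Classical; sound)

p q : Formula
p = var 0
q = var 1

excludedMiddle peirceLaw : Sequent
excludedMiddle = [] ⇒ p ∨ ∼ p
peirceLaw      = [ (p ⟶ q) ⟶ p ] ⇒ p

swapped : ∀ {α β : Formula} {Γ} → α ∷ β ∷ Γ ∼[ set ] β ∷ α ∷ Γ
swapped = bag-=⇒ (↭⇒∼bag (swap _ _ ↭-refl))

⊢excludedMiddle : ∀ {L} → HasExMiddle L → L ⊢ excludedMiddle
⊢excludedMiddle x = ex-middle x (∨right2 init2) (∨right1 init1)

⊢peirceLaw : ∀ {L} → HasPeirce L → L ⊢ peirceLaw
⊢peirceLaw x =
  Peirce x (resp swapped (⟶left {Γ = [ p ⟶ q ]} {Δ = []} ⊢identity init1))
  where
  ⊢identity = ⟶right (resp swapped (⟶left {Γ = [ p ]} {Δ = []} init1 init1))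

gap : Model
gap = record
  { World   = ⊤
  ; _≤_     = λ _ _ → ⊤
  ; ≤-refl  = tt
  ; ≤-trans = const
  ; V⁺      = λ _ _ → ⊥
  ; V⁻      = λ _ _ → ⊥
  ; V⁺-mono = λ _ ()
  ; V⁻-mono = λ _ ()
  }

gap-classical : Classical gap
gap-classical = record
  { ≤-sym = λ _ → tt
  ; V⁺?   = λ _ _ → no λ ()
  ; V⁻?   = λ _ _ → no λ ()
  }

gap-refutes : ¬ Valid gap excludedMiddle
gap-refutes valid with valid []
... | inj₁ ()
... | inj₂ ()

step : Model
step = record
  { World   = Bool
  ; _≤_     = _≤ᵇ_
  ; ≤-refl  = b≤b
  ; ≤-trans = Bool.≤-trans
  ; V⁺      = λ n w → n ≡ 0 × T w
  ; V⁻      = λ _ _ → ⊤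
  ; V⁺-mono = λ { b≤b a → a ; f≤t (_ , ()) }
  ; V⁻-mono = λ _ _ → tt
  }

step-total : Total step
step-total _ _ = inj₂ tt

step-refutes : ¬ Valid step peirceLaw
step-refutes valid = proj₂ (valid {false} (premise ∷ []))
  where
  open Forcing step using (_⊩_)

  ⊮p⟶q : ∀ {w} → ¬ (w ⊩ p ⟶ q)
  ⊮p⟶q {w} f with () ← f (Bool.≤-maximum w) (refl , tt)

  premise : false ⊩ (p ⟶ q) ⟶ p
  premise {v} _ f = contradiction (λ {u} → f {u}) (⊮p⟶q {v})

⊬excludedMiddle : ∀ {L} → ¬ HasExMiddle L → ¬ (L ⊢ excludedMiddle)
⊬excludedMiddle ¬x d =
  gap-refutes (sound gap (λ x → contradiction x ¬x) (const gap-classical) d)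

⊬peirceLaw : ∀ {L} → ¬ HasPeirce L → ¬ (L ⊢ peirceLaw)
⊬peirceLaw ¬x d =
  step-refutes (sound step (const step-total) (λ x → contradiction x ¬x) d)

⊢excludedMiddle? : ∀ L → Dec (L ⊢ excludedMiddle)
⊢excludedMiddle? sC  = no (⊬excludedMiddle λ ())
⊢excludedMiddle? sC3 = yes (⊢excludedMiddle sC3)
⊢excludedMiddle? sMC = no (⊬excludedMiddle λ ())
⊢excludedMiddle? sCN = yes (⊢excludedMiddle sCN)

⊢peirceLaw? : ∀ L → Dec (L ⊢ peirceLaw)
⊢peirceLaw? sC  = no (⊬peirceLaw λ ())
⊢peirceLaw? sC3 = no (⊬peirceLaw λ ())
⊢peirceLaw? sMC = yes (⊢peirceLaw sMC)
⊢peirceLaw? sCN = yes (⊢peirceLaw sCN)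

fromRules : (exMiddle peirce : Bool) → Calculus
fromRules false false = sC
fromRules true  false = sC3
fromRules false true  = sMC
fromRules true  true  = sCN

fromRules-does : ∀ L → fromRules (does (⊢excludedMiddle? L)) (does (⊢peirceLaw? L)) ≡ L
fromRules-does sC  = refl
fromRules-does sC3 = refl
fromRules-does sMC = refl
fromRules-does sCN = refl

theorem2p7 : (L L′ : Calculus) → L ≢ L′ → ¬ (Provable L ≐ Provable L′)
theorem2p7 L L′ L≢L′ (L⊆L′ , L′⊆L) = L≢L′ (begin
  L
    ≡⟨ fromRules-does L ⟨
  fromRules (does (⊢excludedMiddle? L)) (does (⊢peirceLaw? L))
    ≡⟨ cong₂ fromRules (does-⇔ (mk⇔ L⊆L′ L′⊆L) (⊢excludedMiddle? L) (⊢excludedMiddle? L′))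
                       (does-⇔ (mk⇔ L⊆L′ L′⊆L) (⊢peirceLaw? L) (⊢peirceLaw? L′)) ⟩
  fromRules (does (⊢excludedMiddle? L′)) (does (⊢peirceLaw? L′))
    ≡⟨ fromRules-does L′ ⟩
  L′ ∎)
  where open ≡-Reasoning
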